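{- For all $\Delta \in \mathbb{N}$ (with $\Delta\ge 1$) and $\gamma \in \bigl(0, \frac{1}{2\Delta}\bigr)$, let $G$ be an $n$-vertex graph with minimum degree $\delta(G) \geq \bigl(\frac{2\Delta-1}{2\Delta} + \gamma \bigr)n$ and let $H$ be an $n$-vertex graph with maximum degree $\Delta(H) \leq \Delta$. Suppose $S \subseteq V(H)$ is a set of vertices of size $|S| \leq \gamma \Delta n$ and $\varphi_S: S \to V(G)$ is an embedding of the induced subgraph $H[S]$ into $G$. Then there exists an embedding $\varphi$ of $H$ into $G$ that extends the given embedding $\varphi_S$.
   Context: All graphs are simple and finite. An embedding of a graph $H$ into a graph $G$ is an injective map $\varphi:V(H)\to V(G)$ such that $\varphi(x)\varphi(y)\in E(G)$ for every edge $xy\in E(H)$. The map $\varphi$ extends $\varphi_S$ if its restriction to $S$ equals $\varphi_S$. -}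

module Defs where

open import Algebra.Bundles using (module CommutativeMonoid)
import Algebra.Properties.CommutativeSemigroup as CommutativeSemigroupProperties
open import Data.Fin.Base using (Fin)
open import Data.Fin.Subset using (Subset; _∈_; ∣_∣)
import Data.Integer.Base as ℤ
open import Data.List.Base as List using (allFin)
open import Data.List.Extrema.Nat using (min; max)
open import Data.Nat.Base as ℕ using (ℕ; zero; suc; NonZero)
import Data.Nat.Properties as ℕ
open import Data.Product.Base using (Σ-syntax; ∃-syntax; _,_; proj₁)
open import Data.Rational.Base as ℚ using (ℚ; 0ℚ; ½; _/_)
import Data.Rational.Properties as ℚ
open import Data.Vec.Base using (tabulate)
open import Function.Definitions using (Injective)
open import Relation.Binary.Definitions using (Decidable)
open import Relation.Binary.PropositionalEquality
  using (_≡_; sym; trans; subst; cong)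
open import Relation.Nullary.Decidable.Core using (does)
open import Relation.Nullary.Negation.Core using (¬_)

------------------------------------------------------------------------
-- Real numbers, as Cauchy sequences of rationals

record ℝ : Set where
  field
    seq    : ℕ → ℚ
    cauchy : ∀ ε → 0ℚ ℚ.< ε →
             ∃[ N ] (∀ i j → N ℕ.≤ i → N ℕ.≤ j →
                     ℚ.∣ seq i ℚ.- seq j ∣ ℚ.< ε)

open ℝ public

infix  4 _≤ᴿ_ _<ᴿ_
infixl 6 _+ᴿ_
infixr 7 _·_

_<ᴿ_ : ℝ → ℝ → Set
x <ᴿ y = ∃[ ε ] Σ[ _ ∈ 0ℚ ℚ.< ε ] ∃[ N ]
         (∀ i → N ℕ.≤ i → seq x i ℚ.+ ε ℚ.≤ seq y i)

_≤ᴿ_ : ℝ → ℝ → Set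
x ≤ᴿ y = ∀ ε → 0ℚ ℚ.< ε →
         ∃[ N ] (∀ i → N ℕ.≤ i → seq x i ℚ.≤ seq y i ℚ.+ ε)

fromℚ : ℚ → ℝ
fromℚ q .seq _ = q
fromℚ q .cauchy ε 0<ε = 0 , λ _ _ _ _ →
  subst (ℚ._< ε) (sym (cong ℚ.∣_∣ (ℚ.+-inverseʳ q))) 0<ε

fromℕ : ℕ → ℝ
fromℕ n = fromℚ (ℤ.+ n / 1)

private
  0<½*ε : ∀ ε → 0ℚ ℚ.< ε → 0ℚ ℚ.< ½ ℚ.* ε
  0<½*ε ε 0<ε = subst (ℚ._< ½ ℚ.* ε) (ℚ.*-zeroʳ ½) (ℚ.*-monoʳ-<-pos ½ 0<ε)

  [a+b]-[c+d] : ∀ a b c d → (a ℚ.+ b) ℚ.- (c ℚ.+ d) ≡ (a ℚ.- c) ℚ.+ (b ℚ.- d)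
  [a+b]-[c+d] a b c d = trans
    (cong ((a ℚ.+ b) ℚ.+_) (ℚ.neg-distrib-+ c d))
    (interchange a b (ℚ.- c) (ℚ.- d))
    where
    open CommutativeSemigroupProperties
      (CommutativeMonoid.commutativeSemigroup ℚ.+-0-commutativeMonoid)
      using (interchange)

_+ᴿ_ : ℝ → ℝ → ℝ
(x +ᴿ y) .seq i = seq x i ℚ.+ seq y i
(x +ᴿ y) .cauchy ε 0<ε
  with M , p ← cauchy x (½ ℚ.* ε) (0<½*ε ε 0<ε)
     | N , q ← cauchy y (½ ℚ.* ε) (0<½*ε ε 0<ε)
  = M ℕ.⊔ N , λ i j M⊔N≤i M⊔N≤j → begin-strict
    ℚ.∣ (seq x i ℚ.+ seq y i) ℚ.- (seq x j ℚ.+ seq y j) ∣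
      ≡⟨ cong ℚ.∣_∣ ([a+b]-[c+d] (seq x i) (seq y i) (seq x j) (seq y j)) ⟩
    ℚ.∣ (seq x i ℚ.- seq x j) ℚ.+ (seq y i ℚ.- seq y j) ∣
      ≤⟨ ℚ.∣p+q∣≤∣p∣+∣q∣ (seq x i ℚ.- seq x j) (seq y i ℚ.- seq y j) ⟩
    ℚ.∣ seq x i ℚ.- seq x j ∣ ℚ.+ ℚ.∣ seq y i ℚ.- seq y j ∣
      <⟨ ℚ.+-mono-< (p i j (ℕ.m⊔n≤o⇒m≤o M N M⊔N≤i) (ℕ.m⊔n≤o⇒m≤o M N M⊔N≤j))
                    (q i j (ℕ.m⊔n≤o⇒n≤o M N M⊔N≤i) (ℕ.m⊔n≤o⇒n≤o M N M⊔N≤j)) ⟩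
    ½ ℚ.* ε ℚ.+ ½ ℚ.* ε
      ≡⟨ ℚ.*-distribʳ-+ ε ½ ½ ⟨
    (½ ℚ.+ ½) ℚ.* ε
      ≡⟨ ℚ.*-identityˡ ε ⟩
    ε ∎
  where open ℚ.≤-Reasoning

-- The product of a natural number and a real number, by repeated addition.
_·_ : ℕ → ℝ → ℝ
zero  · x = fromℕ 0
suc n · x = x +ᴿ n · x

-- Makes fractions with denominator 2Δ available.
instance
  2*-nonZero : ∀ {m} .{{_ : NonZero m}} → NonZero (2 ℕ.* m)
  2*-nonZero {m} = ℕ.m*n≢0 2 m

------------------------------------------------------------------------
-- Simple graphs

record Graph (V : Set) : Set₁ where
  field
    Adj    : V → V → Set
    Adj?   : Decidable Adj
    symm   : ∀ {u v} → Adj u v → Adj v u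
    irrefl : ∀ {v} → ¬ Adj v v

open Graph public

module _ {n : ℕ} (G : Graph (Fin n)) where

  neighbours : Fin n → Subset n
  neighbours v = tabulate λ w → does (Adj? G v w)

  degree : Fin n → ℕ
  degree v = ∣ neighbours v ∣

  maxDegree : ℕ
  maxDegree = max 0 (List.map degree (allFin n))

  -- Every degree is less than n, so the default value n is attained only
  -- when n = 0; the graph without vertices has minimum degree 0.
  minDegree : ℕ
  minDegree = min n (List.map degree (allFin n))

Vertices : ∀ {n} → Subset n → Set
Vertices S = Σ[ v ∈ _ ] v ∈ S

_[_] : ∀ {n} → Graph (Fin n) → (S : Subset n) → Graph (Vertices S)
(H [ S ]) .Adj  (u , _) (v , _) = Adj H u v
(H [ S ]) .Adj? (u , _) (v , _) = Adj? H u v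
(H [ S ]) .symm                 = symm H
(H [ S ]) .irrefl               = irrefl H

record Embedding {V W : Set} (H : Graph V) (G : Graph W) : Set where
  field
    map       : V → W
    injective : Injective _≡_ _≡_ map
    preserves : ∀ {x y} → Adj H x y → Adj G (map x) (map y)

open Embedding public

infix 4 _Extends_

_Extends_ : ∀ {n} {W : Set} {H : Graph (Fin n)} {G : Graph W} {S : Subset n} →
            Embedding H G → Embedding (H [ S ]) G → Set
_Extends_ {S = S} φ φₛ = ∀ (v : Vertices S) → map φ (proj₁ v) ≡ map φₛ v

{-# OPTIONS --safe #-}
module Submission where

-- Write δ for the minimum degree of G. The hypotheses on δ and S, with
-- γ > 0, give 2Δ(n - δ) + |S| < n whenever n > 0 (`slack`).
--
-- Extend φₛ to a permutation π of the n vertices (`extendToPermutation`),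
-- ignoring the edges for the moment. The vertices x outside S are then
-- repaired one at a time. For a given x, look for a vertex z outside S whose
-- image can be exchanged with that of x: π z should be adjacent to π w for
-- every neighbour w of x, and π x should be adjacent to π w for every
-- neighbour w of z. Each vertex of G has at most n - δ non-neighbours and
-- each vertex of H at most Δ neighbours, so either condition rules out at
-- most Δ(n - δ) vertices z. Together with S this is fewer than n vertices, so
-- a suitable z exists (`exchangePartner`). After the exchange all edges
-- at x and at z are preserved, and the other edges are mapped as before, so no
-- vertex that was repaired earlier is spoiled (`exchange-good`). In the
-- end every edge with an end outside S is preserved; an edge inside S is
-- preserved because π agrees with φₛ there.

open import Defs
open import Data.Nat.Base using (ℕ; NonZero; _≤_; _*_; _∸_)
open import Data.Integer.Base using (+_)
open import Data.Rational.Base using (_/_)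
open import Data.Fin.Base using (Fin)
open import Data.Fin.Subset using (Subset; ∣_∣)
open import Data.Product.Base using (Σ-syntax)

open import Data.Fin.Base using (zero; suc)
open import Data.Fin.Permutation as Perm
  using (Permutation′; _⟨$⟩ʳ_; _⟨$⟩ˡ_; _∘ₚ_; inverseˡ)
open import Data.Fin.Permutation.Components using (transpose)
open import Data.Fin.Properties using (_≟_; injective⇒≤; ¬∀⟶∃¬; nonZeroIndex)
open import Data.Fin.Subset using (inside; outside; ∁; _∈_; _∉_)
open import Data.Fin.Subset.Properties
  using (_∈?_; ∣∁p∣≡n∸∣p∣; x∉p⇒x∈∁p)
open import Data.List.Base as List
  using (List; []; _∷_; _++_; length; concatMap; allFin)
import Data.List.Extrema.Nat as Extrema
open import Data.List.Membership.Propositional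
  using (lose) renaming (_∈_ to _∈ˡ_; _∉_ to _∉ˡ_)
open import Data.List.Membership.Propositional.Properties
  using (∈-allFin; ∈-map⁺; ∈-++⁺ˡ; ∈-++⁺ʳ; ∈-concatMap⁺)
import Data.List.Membership.DecPropositional as DecMembership
open import Data.List.Properties using (length-map; length-++)
import Data.List.Relation.Unary.All as All
open import Data.List.Relation.Unary.Any using (here; there; index)
open import Data.List.Relation.Unary.Any.Properties using (lookup-index)
import Data.Integer.Base as ℤ
import Data.Integer.Properties as ℤ
import Data.Nat.Base as ℕ
import Data.Nat.Properties as ℕ
open import Data.Product.Base using (∃-syntax; _×_; _,_; proj₁; proj₂)
import Data.Rational.Base as ℚ
open import Data.Rational.Base using (ℚ; 0ℚ; 1ℚ; ½)
import Data.Rational.Properties as ℚ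
open import Data.Rational.Solver using (module +-*-Solver)
open import Data.Rational.Unnormalised.Base as ℚᵘ using (mkℚᵘ; *≡*)
import Data.Rational.Unnormalised.Properties as ℚᵘ
open import Data.Vec.Base using ([]; _∷_; here; there)
open import Data.Vec.Properties using (lookup∘tabulate; lookup⇒[]=; []=⇒lookup)
open import Data.Vec.Properties.WithK using ([]=-irrelevant)
open import Function.Base using (_∘_)
open import Function.Definitions using (Injective)
open import Relation.Binary.PropositionalEquality
  using (_≡_; _≢_; refl; sym; trans; cong; cong₂; subst; subst₂; module ≡-Reasoning)
open import Relation.Nullary using (¬_; Dec; yes; no; contradiction)
open import Relation.Nullary.Decidable
  using (dec-true; dec-false; decidable-stable)

-- Natural numbers as rationals

-- The embedding of ℕ in ℚ; every term of the sequence fromℕ m is cast m.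
cast : ℕ → ℚ
cast m = + m / 1

toℚᵘ-cast : ∀ m → ℚ.toℚᵘ (cast m) ℚᵘ.≃ mkℚᵘ (+ m) 0
toℚᵘ-cast m = ℚ.toℚᵘ-fromℚᵘ (mkℚᵘ (+ m) 0)

cast-+ : ∀ m k → cast (m ℕ.+ k) ≡ cast m ℚ.+ cast k
cast-+ m k = ℚ.toℚᵘ-injective (begin-equality
  ℚ.toℚᵘ (cast (m ℕ.+ k))                ≃⟨ toℚᵘ-cast (m ℕ.+ k) ⟩
  mkℚᵘ (+ (m ℕ.+ k)) 0                    ≃⟨ *≡* (cong (ℤ._* + 1) numerators) ⟩
  mkℚᵘ (+ m) 0 ℚᵘ.+ mkℚᵘ (+ k) 0          ≃⟨ ℚᵘ.+-cong (toℚᵘ-cast m) (toℚᵘ-cast k) ⟨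
  ℚ.toℚᵘ (cast m) ℚᵘ.+ ℚ.toℚᵘ (cast k)    ≃⟨ ℚ.toℚᵘ-homo-+ (cast m) (cast k) ⟨
  ℚ.toℚᵘ (cast m ℚ.+ cast k)              ∎)
  where
  open ℚᵘ.≤-Reasoning
  numerators : + (m ℕ.+ k) ≡ + m ℤ.* + 1 ℤ.+ + k ℤ.* + 1
  numerators = sym (cong₂ ℤ._+_ (ℤ.*-identityʳ (+ m)) (ℤ.*-identityʳ (+ k)))

cast-* : ∀ m k → cast (m * k) ≡ cast m ℚ.* cast k
cast-* m k = ℚ.toℚᵘ-injective (begin-equality
  ℚ.toℚᵘ (cast (m * k))                   ≃⟨ toℚᵘ-cast (m * k) ⟩
  mkℚᵘ (+ (m * k)) 0                      ≃⟨ *≡* (cong (ℤ._* + 1) (ℤ.pos-* m k)) ⟩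
  mkℚᵘ (+ m) 0 ℚᵘ.* mkℚᵘ (+ k) 0          ≃⟨ ℚᵘ.*-cong (toℚᵘ-cast m) (toℚᵘ-cast k) ⟨
  ℚ.toℚᵘ (cast m) ℚᵘ.* ℚ.toℚᵘ (cast k)    ≃⟨ ℚ.toℚᵘ-homo-* (cast m) (cast k) ⟨
  ℚ.toℚᵘ (cast m ℚ.* cast k)              ∎)
  where open ℚᵘ.≤-Reasoning

cast-mono-≤ : ∀ {m k} → m ≤ k → cast m ℚ.≤ cast k
cast-mono-≤ {m} {k} m≤k = ℚ.toℚᵘ-cancel-≤ (begin
  ℚ.toℚᵘ (cast m)  ≃⟨ toℚᵘ-cast m ⟩
  mkℚᵘ (+ m) 0     ≤⟨ ℚᵘ.*≤* (ℤ.*-monoʳ-≤-nonNeg (+ 1) (ℤ.+≤+ m≤k)) ⟩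
  mkℚᵘ (+ k) 0     ≃⟨ toℚᵘ-cast k ⟨
  ℚ.toℚᵘ (cast k)  ∎)
  where open ℚᵘ.≤-Reasoning

cast-cancel-< : ∀ {m k} → cast m ℚ.< cast k → m ℕ.< k
cast-cancel-< m<k = ℕ.≰⇒> λ k≤m → ℚ.<-irrefl refl (ℚ.<-≤-trans m<k (cast-mono-≤ k≤m))

cast-*-/ : ∀ m .{{_ : NonZero m}} k → cast m ℚ.* (+ k / m) ≡ cast k
cast-*-/ (ℕ.suc m-1) k = ℚ.toℚᵘ-injective (begin-equality
  ℚ.toℚᵘ (cast m ℚ.* (+ k / m))           ≃⟨ ℚ.toℚᵘ-homo-* (cast m) (+ k / m) ⟩
  ℚ.toℚᵘ (cast m) ℚᵘ.* ℚ.toℚᵘ (+ k / m)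
    ≃⟨ ℚᵘ.*-cong (toℚᵘ-cast m) (ℚ.toℚᵘ-fromℚᵘ (mkℚᵘ (+ k) m-1)) ⟩
  mkℚᵘ (+ m) 0 ℚᵘ.* mkℚᵘ (+ k) m-1         ≃⟨ *≡* crossMultiplied ⟩
  mkℚᵘ (+ k) 0                            ≃⟨ toℚᵘ-cast k ⟨
  ℚ.toℚᵘ (cast k)                         ∎)
  where
  open ℚᵘ.≤-Reasoning
  m = ℕ.suc m-1
  crossMultiplied : (+ m ℤ.* + k) ℤ.* + 1 ≡ + k ℤ.* + (1 * m)
  crossMultiplied = trans (ℤ.*-identityʳ (+ m ℤ.* + k))
    (trans (ℤ.*-comm (+ m) (+ k)) (cong ((+ k ℤ.*_) ∘ +_) (sym (ℕ.*-identityˡ m))))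

seq-· : ∀ m x i → seq (m · x) i ≡ cast m ℚ.* seq x i
seq-· ℕ.zero    x i = sym (ℚ.*-zeroˡ (seq x i))
seq-· (ℕ.suc m) x i = begin
  seq x i ℚ.+ seq (m · x) i                    ≡⟨ cong₂ ℚ._+_ (sym (ℚ.*-identityˡ (seq x i))) (seq-· m x i) ⟩
  1ℚ ℚ.* seq x i ℚ.+ cast m ℚ.* seq x i        ≡⟨ ℚ.*-distribʳ-+ (seq x i) 1ℚ (cast m) ⟨
  (1ℚ ℚ.+ cast m) ℚ.* seq x i                  ≡⟨ cong (ℚ._* seq x i) (cast-+ 1 m) ⟨
  cast (ℕ.suc m) ℚ.* seq x i                   ∎
  where open ≡-Reasoning

-- The numerical content of the hypotheses

+-cancelʳ-< : ∀ r {p q} → p ℚ.+ r ℚ.< q ℚ.+ r → p ℚ.< q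
+-cancelʳ-< r {p} {q} p+r<q+r =
  subst₂ ℚ._<_ (cancel p r) (cancel q r) (ℚ.+-monoˡ-< (ℚ.- r) p+r<q+r)
  where
  open +-*-Solver
  cancel : ∀ p r → p ℚ.+ r ℚ.- r ≡ p
  cancel = solve 2 (λ p r → p :+ r :- r := p) refl

-- Here D, N, d, s and g stand for Δ, n, δ, |S| and γ, and c for
-- (2Δ - 1)/(2Δ), while e is the error allowed when the two hypotheses on
-- reals are read off at a late index of the sequences. The surplus N D g
-- absorbs the total error (2D + 1) e since 4 e ≤ g and D, N ≥ 1.
slackℚ : ∀ D N d s g c e → 0ℚ ℚ.< e → 1ℚ ℚ.≤ D → 1ℚ ℚ.≤ N →
         D ℚ.* c ℚ.+ D ℚ.* c ℚ.+ 1ℚ ≡ D ℚ.+ D →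
         (e ℚ.+ e) ℚ.+ (e ℚ.+ e) ℚ.≤ g →
         N ℚ.* (c ℚ.+ g) ℚ.≤ d ℚ.+ e →
         s ℚ.≤ N ℚ.* (D ℚ.* g) ℚ.+ e →
         (D ℚ.+ D) ℚ.* N ℚ.+ s ℚ.< N ℚ.+ (D ℚ.+ D) ℚ.* d
slackℚ D N d s g c e 0<e 1≤D 1≤N Dc 4e≤g degree-bound size-bound =
  +-cancelʳ-< (surplus ℚ.+ surplus) (begin-strict
    (D ℚ.+ D) ℚ.* N ℚ.+ s ℚ.+ (surplus ℚ.+ surplus)
      ≡⟨ cong (λ t → t ℚ.* N ℚ.+ s ℚ.+ (surplus ℚ.+ surplus)) Dc ⟨
    (D ℚ.* c ℚ.+ D ℚ.* c ℚ.+ 1ℚ) ℚ.* N ℚ.+ s ℚ.+ (surplus ℚ.+ surplus)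
      ≡⟨ regroupˡ D N s g c ⟩
    N ℚ.+ ((D ℚ.+ D) ℚ.* (N ℚ.* (c ℚ.+ g)) ℚ.+ s)
      ≤⟨ ℚ.+-monoʳ-≤ N (ℚ.+-mono-≤ (ℚ.*-monoˡ-≤-nonNeg (D ℚ.+ D) degree-bound) size-bound) ⟩
    N ℚ.+ ((D ℚ.+ D) ℚ.* (d ℚ.+ e) ℚ.+ (surplus ℚ.+ e))
      ≡⟨ regroupʳ D N d surplus e ⟩
    N ℚ.+ (D ℚ.+ D) ℚ.* d ℚ.+ (surplus ℚ.+ (D ℚ.* (e ℚ.+ e) ℚ.+ 1ℚ ℚ.* e))
      <⟨ ℚ.+-monoʳ-< (N ℚ.+ (D ℚ.+ D) ℚ.* d) (ℚ.+-monoʳ-< surplus error<surplus) ⟩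
    N ℚ.+ (D ℚ.+ D) ℚ.* d ℚ.+ (surplus ℚ.+ surplus) ∎)
  where
  open ℚ.≤-Reasoning
  surplus = N ℚ.* (D ℚ.* g)

  instance
    D-pos : ℚ.Positive D
    D-pos = ℚ.positive (ℚ.<-≤-trans (ℚ.positive⁻¹ 1ℚ) 1≤D)
    D-nonNeg : ℚ.NonNegative D
    D-nonNeg = ℚ.pos⇒nonNeg D
    2D-nonNeg : ℚ.NonNegative (D ℚ.+ D)
    2D-nonNeg = ℚ.nonNeg+nonNeg⇒nonNeg D D
    e-nonNeg : ℚ.NonNegative e
    e-nonNeg = ℚ.nonNegative (ℚ.<⇒≤ 0<e)
    2e-nonNeg : ℚ.NonNegative (e ℚ.+ e)
    2e-nonNeg = ℚ.nonNeg+nonNeg⇒nonNeg e e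
    4e-nonNeg : ℚ.NonNegative (e ℚ.+ e ℚ.+ (e ℚ.+ e))
    4e-nonNeg = ℚ.nonNeg+nonNeg⇒nonNeg (e ℚ.+ e) (e ℚ.+ e)

  0≤g : 0ℚ ℚ.≤ g
  0≤g = ℚ.≤-trans (ℚ.nonNegative⁻¹ (e ℚ.+ e ℚ.+ (e ℚ.+ e))) 4e≤g

  0≤Dg : 0ℚ ℚ.≤ D ℚ.* g
  0≤Dg = subst (ℚ._≤ D ℚ.* g) (ℚ.*-zeroʳ D) (ℚ.*-monoˡ-≤-nonNeg D 0≤g)

  error<surplus : D ℚ.* (e ℚ.+ e) ℚ.+ 1ℚ ℚ.* e ℚ.< surplus
  error<surplus = begin-strict
    D ℚ.* (e ℚ.+ e) ℚ.+ 1ℚ ℚ.* e   ≤⟨ ℚ.+-monoʳ-≤ (D ℚ.* (e ℚ.+ e)) (ℚ.*-monoʳ-≤-nonNeg e 1≤D) ⟩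
    D ℚ.* (e ℚ.+ e) ℚ.+ D ℚ.* e    ≡⟨ ℚ.*-distribˡ-+ D (e ℚ.+ e) e ⟨
    D ℚ.* (e ℚ.+ e ℚ.+ e)          <⟨ ℚ.*-monoʳ-<-pos D (ℚ.+-monoʳ-< (e ℚ.+ e) e<2e) ⟩
    D ℚ.* (e ℚ.+ e ℚ.+ (e ℚ.+ e))  ≤⟨ ℚ.*-monoˡ-≤-nonNeg D 4e≤g ⟩
    D ℚ.* g                        ≡⟨ ℚ.*-identityˡ (D ℚ.* g) ⟨
    1ℚ ℚ.* (D ℚ.* g)               ≤⟨ ℚ.*-monoʳ-≤-nonNeg (D ℚ.* g) {{ℚ.nonNegative 0≤Dg}} 1≤N ⟩
    N ℚ.* (D ℚ.* g)                ∎
    where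
    e<2e : e ℚ.< e ℚ.+ e
    e<2e = subst (ℚ._< e ℚ.+ e) (ℚ.+-identityˡ e) (ℚ.+-monoˡ-< e 0<e)

  open +-*-Solver

  regroupˡ : ∀ D N s g c →
    (D ℚ.* c ℚ.+ D ℚ.* c ℚ.+ 1ℚ) ℚ.* N ℚ.+ s ℚ.+ (N ℚ.* (D ℚ.* g) ℚ.+ N ℚ.* (D ℚ.* g)) ≡
    N ℚ.+ ((D ℚ.+ D) ℚ.* (N ℚ.* (c ℚ.+ g)) ℚ.+ s)
  regroupˡ = solve 5 (λ D N s g c →
    (D :* c :+ D :* c :+ con 1ℚ) :* N :+ s :+ (N :* (D :* g) :+ N :* (D :* g)) :=
    N :+ ((D :+ D) :* (N :* (c :+ g)) :+ s)) refl

  regroupʳ : ∀ D N d x e →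
    N ℚ.+ ((D ℚ.+ D) ℚ.* (d ℚ.+ e) ℚ.+ (x ℚ.+ e)) ≡
    N ℚ.+ (D ℚ.+ D) ℚ.* d ℚ.+ (x ℚ.+ (D ℚ.* (e ℚ.+ e) ℚ.+ 1ℚ ℚ.* e))
  regroupʳ = solve 5 (λ D N d x e →
    N :+ ((D :+ D) :* (d :+ e) :+ (x :+ e)) :=
    N :+ (D :+ D) :* d :+ (x :+ (D :* (e :+ e) :+ con 1ℚ :* e))) refl

-- Read off both hypotheses on reals at one index i, late enough for an error
-- of e = ε/4, where ε is a positive lower bound of γ, and clear denominators.
slack : ∀ Δ .{{_ : NonZero Δ}} (γ : ℝ) → fromℕ 0 <ᴿ γ →
        ∀ n .{{_ : NonZero n}} δ s → δ ≤ n →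
        n · (fromℚ (+ (2 * Δ ∸ 1) / (2 * Δ)) +ᴿ γ) ≤ᴿ fromℕ δ →
        fromℕ s ≤ᴿ n · Δ · γ →
        2 * Δ * (n ∸ δ) ℕ.+ s ℕ.< n
slack Δ γ (ε , 0<ε , K , 0+ε≤γ) n δ s δ≤n δ-large s-small =
  ℕ.+-cancelʳ-< (2 * Δ * δ) (2 * Δ * (n ∸ δ) ℕ.+ s) n
    (subst (ℕ._< n ℕ.+ 2 * Δ * δ) restore (cast-cancel-< (subst₂ ℚ._<_ castˡ castʳ
      (slackℚ (cast Δ) (cast n) (cast δ) (cast s) (seq γ i) c e 0<e
        (cast-mono-≤ (ℕ.>-nonZero⁻¹ Δ)) (cast-mono-≤ (ℕ.>-nonZero⁻¹ n))
        2Δc 4e≤γᵢ degree-bound size-bound))))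
  where
  c = + (2 * Δ ∸ 1) / (2 * Δ)
  e = ½ ℚ.* (½ ℚ.* ε)

  halve : ∀ {p} → 0ℚ ℚ.< p → 0ℚ ℚ.< ½ ℚ.* p
  halve {p} 0<p = subst (ℚ._< ½ ℚ.* p) (ℚ.*-zeroʳ ½) (ℚ.*-monoʳ-<-pos ½ 0<p)

  0<e : 0ℚ ℚ.< e
  0<e = halve (halve 0<ε)

  L = proj₁ (δ-large e 0<e)
  M = proj₁ (s-small e 0<e)
  i = K ℕ.⊔ (L ℕ.⊔ M)

  4e≤γᵢ : e ℚ.+ e ℚ.+ (e ℚ.+ e) ℚ.≤ seq γ i
  4e≤γᵢ = subst (ℚ._≤ seq γ i) (quarters ε) (0+ε≤γ i (ℕ.m≤m⊔n K (L ℕ.⊔ M)))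
    where
    open +-*-Solver
    quarters : ∀ ε → 0ℚ ℚ.+ ε ≡
      ½ ℚ.* (½ ℚ.* ε) ℚ.+ ½ ℚ.* (½ ℚ.* ε) ℚ.+ (½ ℚ.* (½ ℚ.* ε) ℚ.+ ½ ℚ.* (½ ℚ.* ε))
    quarters = solve 1 (λ ε → let q = con ½ :* (con ½ :* ε) in
      con 0ℚ :+ ε := q :+ q :+ (q :+ q)) refl

  degree-bound : cast n ℚ.* (c ℚ.+ seq γ i) ℚ.≤ cast δ ℚ.+ e
  degree-bound = subst (ℚ._≤ cast δ ℚ.+ e) (seq-· n (fromℚ c +ᴿ γ) i)
    (proj₂ (δ-large e 0<e) i (ℕ.≤-trans (ℕ.m≤m⊔n L M) (ℕ.m≤n⊔m K (L ℕ.⊔ M))))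

  size-bound : cast s ℚ.≤ cast n ℚ.* (cast Δ ℚ.* seq γ i) ℚ.+ e
  size-bound = subst (λ t → cast s ℚ.≤ t ℚ.+ e)
    (trans (seq-· n (Δ · γ) i) (cong (cast n ℚ.*_) (seq-· Δ γ i)))
    (proj₂ (s-small e 0<e) i (ℕ.≤-trans (ℕ.m≤n⊔m L M) (ℕ.m≤n⊔m K (L ℕ.⊔ M))))

  cast-2Δ : cast (2 * Δ) ≡ cast Δ ℚ.+ cast Δ
  cast-2Δ = trans (cong (λ t → cast (Δ ℕ.+ t)) (ℕ.+-identityʳ Δ)) (cast-+ Δ Δ)

  2Δc : cast Δ ℚ.* c ℚ.+ cast Δ ℚ.* c ℚ.+ 1ℚ ≡ cast Δ ℚ.+ cast Δ
  2Δc = begin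
    cast Δ ℚ.* c ℚ.+ cast Δ ℚ.* c ℚ.+ 1ℚ  ≡⟨ cong (ℚ._+ 1ℚ) (ℚ.*-distribʳ-+ c (cast Δ) (cast Δ)) ⟨
    (cast Δ ℚ.+ cast Δ) ℚ.* c ℚ.+ 1ℚ      ≡⟨ cong (λ t → t ℚ.* c ℚ.+ 1ℚ) cast-2Δ ⟨
    cast (2 * Δ) ℚ.* c ℚ.+ 1ℚ             ≡⟨ cong (ℚ._+ 1ℚ) (cast-*-/ (2 * Δ) (2 * Δ ∸ 1)) ⟩
    cast (2 * Δ ∸ 1) ℚ.+ cast 1           ≡⟨ cast-+ (2 * Δ ∸ 1) 1 ⟨
    cast (2 * Δ ∸ 1 ℕ.+ 1)                ≡⟨ cong cast (ℕ.m∸n+n≡m (ℕ.>-nonZero⁻¹ (2 * Δ))) ⟩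
    cast (2 * Δ)                          ≡⟨ cast-2Δ ⟩
    cast Δ ℚ.+ cast Δ                     ∎
    where open ≡-Reasoning

  cast-2Δ* : ∀ m → (cast Δ ℚ.+ cast Δ) ℚ.* cast m ≡ cast (2 * Δ * m)
  cast-2Δ* m = sym (trans (cast-* (2 * Δ) m) (cong (ℚ._* cast m) cast-2Δ))

  castˡ : (cast Δ ℚ.+ cast Δ) ℚ.* cast n ℚ.+ cast s ≡ cast (2 * Δ * n ℕ.+ s)
  castˡ = trans (cong (ℚ._+ cast s) (cast-2Δ* n)) (sym (cast-+ (2 * Δ * n) s))

  castʳ : cast n ℚ.+ (cast Δ ℚ.+ cast Δ) ℚ.* cast δ ≡ cast (n ℕ.+ 2 * Δ * δ)
  castʳ = trans (cong (cast n ℚ.+_) (cast-2Δ* δ)) (sym (cast-+ n (2 * Δ * δ)))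

  restore : 2 * Δ * n ℕ.+ s ≡ 2 * Δ * (n ∸ δ) ℕ.+ s ℕ.+ 2 * Δ * δ
  restore = begin
    2 * Δ * n ℕ.+ s                            ≡⟨ cong (λ t → 2 * Δ * t ℕ.+ s) (ℕ.m∸n+n≡m δ≤n) ⟨
    2 * Δ * (n ∸ δ ℕ.+ δ) ℕ.+ s                ≡⟨ cong (ℕ._+ s) (ℕ.*-distribˡ-+ (2 * Δ) (n ∸ δ) δ) ⟩
    2 * Δ * (n ∸ δ) ℕ.+ 2 * Δ * δ ℕ.+ s        ≡⟨ ℕ.+-assoc (2 * Δ * (n ∸ δ)) (2 * Δ * δ) s ⟩
    2 * Δ * (n ∸ δ) ℕ.+ (2 * Δ * δ ℕ.+ s)      ≡⟨ cong (2 * Δ * (n ∸ δ) ℕ.+_) (ℕ.+-comm (2 * Δ * δ) s) ⟩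
    2 * Δ * (n ∸ δ) ℕ.+ (s ℕ.+ 2 * Δ * δ)      ≡⟨ ℕ.+-assoc (2 * Δ * (n ∸ δ)) s (2 * Δ * δ) ⟨
    2 * Δ * (n ∸ δ) ℕ.+ s ℕ.+ 2 * Δ * δ        ∎
    where open ≡-Reasoning

-- Listing and counting vertices

-- The elements of a subset in increasing order, without repetition.
elements : ∀ {n} → Subset n → List (Fin n)
elements []            = []
elements (inside  ∷ p) = zero ∷ List.map suc (elements p)
elements (outside ∷ p) = List.map suc (elements p)

length-elements : ∀ {n} (p : Subset n) → length (elements p) ≡ ∣ p ∣
length-elements []            = refl
length-elements (inside  ∷ p) =
  cong ℕ.suc (trans (length-map suc (elements p)) (length-elements p))
length-elements (outside ∷ p) = trans (length-map suc (elements p)) (length-elements p)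

∈-elements : ∀ {n} {p : Subset n} {v} → v ∈ p → v ∈ˡ elements p
∈-elements {p = inside  ∷ _} here        = here refl
∈-elements {p = inside  ∷ _} (there v∈p) = there (∈-map⁺ suc (∈-elements v∈p))
∈-elements {p = outside ∷ _} (there v∈p) = ∈-map⁺ suc (∈-elements v∈p)

length-concatMap-≤ : ∀ {A B : Set} (f : A → List B) k → (∀ x → length (f x) ≤ k) →
                     ∀ xs → length (concatMap f xs) ≤ length xs * k
length-concatMap-≤ f k f≤k []       = ℕ.z≤n
length-concatMap-≤ f k f≤k (x ∷ xs) = begin
  length (f x ++ concatMap f xs)             ≡⟨ length-++ (f x) ⟩
  length (f x) ℕ.+ length (concatMap f xs)   ≤⟨ ℕ.+-mono-≤ (f≤k x) (length-concatMap-≤ f k f≤k xs) ⟩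
  k ℕ.+ length xs * k                        ∎
  where open ℕ.≤-Reasoning

short⇒missing : ∀ {n} (xs : List (Fin n)) → length xs ℕ.< n → ∃[ z ] z ∉ˡ xs
short⇒missing {n} xs short = ¬∀⟶∃¬ n (_∈ˡ xs) (λ z → DecMembership._∈?_ _≟_ z xs) notAll
  where
  notAll : ¬ (∀ z → z ∈ˡ xs)
  notAll all = ℕ.<⇒≱ short (injective⇒≤ {f = index ∘ all} λ {y} {z} eq →
    trans (lookup-index (all y)) (trans (cong (List.lookup xs) eq) (sym (lookup-index (all z)))))

module _ {n : ℕ} (G : Graph (Fin n)) where

  Adj⇒∈neighbours : ∀ {v w} → Adj G v w → w ∈ neighbours G v
  Adj⇒∈neighbours {v} {w} vw = lookup⇒[]= w (neighbours G v)
    (trans (lookup∘tabulate _ w) (dec-true (Adj? G v w) vw))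

  ∈neighbours⇒Adj : ∀ {v w} → w ∈ neighbours G v → Adj G v w
  ∈neighbours⇒Adj {v} {w} w∈ = decidable-stable (Adj? G v w) λ ¬vw →
    contradiction (trans (sym (dec-false (Adj? G v w) ¬vw))
                         (trans (sym (lookup∘tabulate _ w)) ([]=⇒lookup w∈))) λ ()

  -- The neighbours of v in increasing order.
  neighbourList : Fin n → List (Fin n)
  neighbourList v = elements (neighbours G v)

  -- The vertices not adjacent to v, including v itself.
  nonNeighbourList : Fin n → List (Fin n)
  nonNeighbourList v = elements (∁ (neighbours G v))

  ∈-neighbourList : ∀ {v w} → Adj G v w → w ∈ˡ neighbourList v
  ∈-neighbourList = ∈-elements ∘ Adj⇒∈neighbours

  ∈-nonNeighbourList : ∀ {v w} → ¬ Adj G v w → w ∈ˡ nonNeighbourList v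
  ∈-nonNeighbourList ¬vw = ∈-elements (x∉p⇒x∈∁p (¬vw ∘ ∈neighbours⇒Adj))

  length-neighbourList : ∀ v → length (neighbourList v) ≤ maxDegree G
  length-neighbourList v = ℕ.≤-trans (ℕ.≤-reflexive (length-elements (neighbours G v)))
    (All.lookup (Extrema.xs≤max 0 (List.map (degree G) (allFin n)))
                (∈-map⁺ (degree G) (∈-allFin v)))

  length-nonNeighbourList : ∀ v → length (nonNeighbourList v) ≤ n ∸ minDegree G
  length-nonNeighbourList v = begin
    length (nonNeighbourList v)  ≡⟨ length-elements (∁ (neighbours G v)) ⟩
    ∣ ∁ (neighbours G v) ∣       ≡⟨ ∣∁p∣≡n∸∣p∣ (neighbours G v) ⟩
    n ∸ degree G v               ≤⟨ ℕ.∸-monoʳ-≤ n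
      (All.lookup (Extrema.min≤xs n (List.map (degree G) (allFin n)))
                  (∈-map⁺ (degree G) (∈-allFin v))) ⟩
    n ∸ minDegree G              ∎
    where open ℕ.≤-Reasoning

  minDegree≤n : minDegree G ≤ n
  minDegree≤n = Extrema.min≤⊤ n (List.map (degree G) (allFin n))

-- Transpositions and extension to a permutation

module _ {n : ℕ} where

  transpose-left : ∀ (i j : Fin n) → transpose i j i ≡ j
  transpose-left i j rewrite dec-true (i ≟ i) refl = refl

  transpose-right : ∀ (i j : Fin n) → transpose i j j ≡ i
  transpose-right i j with j ≟ i
  ... | yes j≡i = j≡i
  ... | no  _   rewrite dec-true (j ≟ j) refl = refl

  transpose-other : ∀ (i j : Fin n) {k} → k ≢ i → k ≢ j → transpose i j k ≡ k
  transpose-other i j {k} k≢i k≢j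
    rewrite dec-false (k ≟ i) k≢i | dec-false (k ≟ j) k≢j = refl

  ⟨$⟩ʳ-injective : ∀ (π : Permutation′ n) {x y} → π ⟨$⟩ʳ x ≡ π ⟨$⟩ʳ y → x ≡ y
  ⟨$⟩ʳ-injective π eq = trans (sym (inverseˡ π)) (trans (cong (π ⟨$⟩ˡ_) eq) (inverseˡ π))

-- Correct the identity at one element of S after another: the transposition
-- of π x and f x, applied after π, makes x go to f x and moves no image f v
-- that is already attained.
extendToPermutation : ∀ {n} {S : Subset n} (f : Vertices S → Fin n) → Injective _≡_ _≡_ f →
                      ∃[ π ] (∀ v → π ⟨$⟩ʳ proj₁ v ≡ f v)
extendToPermutation {n} {S} f f-injective =
  let π , agrees = agreeOn (allFin n) in π , λ v → agrees v (∈-allFin (proj₁ v))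
  where
  agreeOn : ∀ xs → Σ[ π ∈ Permutation′ n ] (∀ v → proj₁ v ∈ˡ xs → π ⟨$⟩ʳ proj₁ v ≡ f v)
  agreeOn []       = Perm.id , λ _ ()
  agreeOn (x ∷ xs) with agreeOn xs | x ∈? S
  ... | π , agrees | no  x∉S = π , λ where
    (_ , x∈S) (here refl)  → contradiction x∈S x∉S
    v         (there v∈xs) → agrees v v∈xs
  ... | π , agrees | yes x∈S = π ∘ₚ Perm.transpose πx fx , agrees′
    where
    πx = π ⟨$⟩ʳ x
    fx = f (x , x∈S)
    atx : ∀ (v∈S : x ∈ S) → transpose πx fx πx ≡ f (x , v∈S)
    atx v∈S = trans (transpose-left πx fx) (cong (λ p → f (x , p)) ([]=-irrelevant x∈S v∈S))
    agrees′ : ∀ v → proj₁ v ∈ˡ x ∷ xs → transpose πx fx (π ⟨$⟩ʳ proj₁ v) ≡ f v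
    agrees′ (_ , v∈S) (here refl) = atx v∈S
    agrees′ (v , v∈S) (there v∈xs) with v ≟ x
    ... | yes refl = atx v∈S
    ... | no  v≢x  = trans
      (transpose-other πx fx (v≢x ∘ ⟨$⟩ʳ-injective π)
        (λ πv≡fx → v≢x (cong {A = Vertices S} proj₁
          (f-injective (trans (sym (agrees (v , v∈S) v∈xs)) πv≡fx)))))
      (agrees (v , v∈S) v∈xs)

-- Repairing one vertex

module _ {n : ℕ} (G H : Graph (Fin n)) where

  -- All edges of H at x are mapped to edges of G.
  Good : Permutation′ n → Fin n → Set
  Good π x = ∀ {y} → Adj H x y → Adj G (π ⟨$⟩ʳ x) (π ⟨$⟩ʳ y)

  -- The images of x and z may be exchanged: each of the two fits in the place
  -- of the other. This also holds for z = x if x is good.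
  record Exchangeable (π : Permutation′ n) (x z : Fin n) : Set where
    field
      z-for-x : ∀ {w} → Adj H x w → Adj G (π ⟨$⟩ʳ z) (π ⟨$⟩ʳ w)
      x-for-z : ∀ {w} → Adj H z w → Adj G (π ⟨$⟩ʳ x) (π ⟨$⟩ʳ w)

  exchangePartner : ∀ {Δ} → maxDegree H ≤ Δ → (S : Subset n) →
                    2 * Δ * (n ∸ minDegree G) ℕ.+ ∣ S ∣ ℕ.< n →
                    ∀ π x → ∃[ z ] (z ∉ S × Exchangeable π x z)
  exchangePartner {Δ} ΔH≤Δ S few π x = z , z∉S , record { z-for-x = z-for-x ; x-for-z = x-for-z }
    where
    d = n ∸ minDegree G

    -- The w such that π w is not adjacent to v.
    missed : Fin n → List (Fin n)
    missed v = List.map (π ⟨$⟩ˡ_) (nonNeighbourList G v)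

    ∈-missed : ∀ {v w} → ¬ Adj G v (π ⟨$⟩ʳ w) → w ∈ˡ missed v
    ∈-missed {v} ¬vw = subst (_∈ˡ missed v) (inverseˡ π)
      (∈-map⁺ (π ⟨$⟩ˡ_) (∈-nonNeighbourList G ¬vw))

    length-missed : ∀ v → length (missed v) ≤ d
    length-missed v = ℕ.≤-trans (ℕ.≤-reflexive (length-map (π ⟨$⟩ˡ_) (nonNeighbourList G v)))
      (length-nonNeighbourList G v)

    -- The z for which π z is not adjacent to the image of some neighbour of x.
    unfit-for-x : List (Fin n)
    unfit-for-x = concatMap (missed ∘ (π ⟨$⟩ʳ_)) (neighbourList H x)

    -- The z with a neighbour whose image is not adjacent to π x.
    unfit-for-z : List (Fin n)
    unfit-for-z = concatMap (neighbourList H) (missed (π ⟨$⟩ʳ x))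

    degree≤Δ : ∀ v → length (neighbourList H v) ≤ Δ
    degree≤Δ v = ℕ.≤-trans (length-neighbourList H v) ΔH≤Δ

    excluded : List (Fin n)
    excluded = (unfit-for-x ++ unfit-for-z) ++ elements S

    excluded-short : length excluded ℕ.< n
    excluded-short = ℕ.≤-<-trans (begin
      length excluded
        ≡⟨ length-++ (unfit-for-x ++ unfit-for-z) ⟩
      length (unfit-for-x ++ unfit-for-z) ℕ.+ length (elements S)
        ≡⟨ cong₂ ℕ._+_ (length-++ unfit-for-x) (length-elements S) ⟩
      length unfit-for-x ℕ.+ length unfit-for-z ℕ.+ ∣ S ∣
        ≤⟨ ℕ.+-monoˡ-≤ ∣ S ∣ (ℕ.+-mono-≤
             (ℕ.≤-trans (length-concatMap-≤ _ d (λ w → length-missed (π ⟨$⟩ʳ w)) (neighbourList H x))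
                        (ℕ.*-monoˡ-≤ d (degree≤Δ x)))
             (ℕ.≤-trans (length-concatMap-≤ _ Δ degree≤Δ (missed (π ⟨$⟩ʳ x)))
                        (ℕ.*-monoˡ-≤ Δ (length-missed (π ⟨$⟩ʳ x))))) ⟩
      Δ * d ℕ.+ d * Δ ℕ.+ ∣ S ∣
        ≡⟨ cong (λ t → Δ * d ℕ.+ t ℕ.+ ∣ S ∣) (ℕ.*-comm d Δ) ⟩
      Δ * d ℕ.+ Δ * d ℕ.+ ∣ S ∣
        ≡⟨ cong (ℕ._+ ∣ S ∣) (ℕ.*-distribʳ-+ d Δ Δ) ⟨
      (Δ ℕ.+ Δ) * d ℕ.+ ∣ S ∣
        ≡⟨ cong (λ t → (Δ ℕ.+ t) * d ℕ.+ ∣ S ∣) (ℕ.+-identityʳ Δ) ⟨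
      2 * Δ * d ℕ.+ ∣ S ∣ ∎) few
      where open ℕ.≤-Reasoning

    z = proj₁ (short⇒missing excluded excluded-short)

    z∉excluded : z ∉ˡ excluded
    z∉excluded = proj₂ (short⇒missing excluded excluded-short)

    z∉S : z ∉ S
    z∉S z∈S = z∉excluded (∈-++⁺ʳ (unfit-for-x ++ unfit-for-z) (∈-elements z∈S))

    z-for-x : ∀ {w} → Adj H x w → Adj G (π ⟨$⟩ʳ z) (π ⟨$⟩ʳ w)
    z-for-x {w} xw = symm G (decidable-stable (Adj? G (π ⟨$⟩ʳ w) (π ⟨$⟩ʳ z)) λ ¬wz →
      z∉excluded (∈-++⁺ˡ (∈-++⁺ˡ (∈-concatMap⁺ (missed ∘ (π ⟨$⟩ʳ_))
        (lose (∈-neighbourList H xw) (∈-missed ¬wz))))))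

    x-for-z : ∀ {w} → Adj H z w → Adj G (π ⟨$⟩ʳ x) (π ⟨$⟩ʳ w)
    x-for-z {w} zw = decidable-stable (Adj? G (π ⟨$⟩ʳ x) (π ⟨$⟩ʳ w)) λ ¬xw →
      z∉excluded (∈-++⁺ˡ (∈-++⁺ʳ unfit-for-x (∈-concatMap⁺ (neighbourList H)
        (lose (∈-missed ¬xw) (∈-neighbourList H (symm H zw))))))

  -- The permutation π with the images of x and z swapped.
  exchange : Permutation′ n → Fin n → Fin n → Permutation′ n
  exchange π x z = Perm.transpose x z ∘ₚ π

  module _ (π : Permutation′ n) {x z : Fin n} (ex : Exchangeable π x z) where
    open Exchangeable ex

    private
      π′ = exchange π x z

      at-x : π′ ⟨$⟩ʳ x ≡ π ⟨$⟩ʳ z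
      at-x = cong (π ⟨$⟩ʳ_) (transpose-left x z)

      at-z : π′ ⟨$⟩ʳ z ≡ π ⟨$⟩ʳ x
      at-z = cong (π ⟨$⟩ʳ_) (transpose-right x z)

      elsewhere : ∀ {v} → v ≢ x → v ≢ z → π′ ⟨$⟩ʳ v ≡ π ⟨$⟩ʳ v
      elsewhere v≢x v≢z = cong (π ⟨$⟩ʳ_) (transpose-other x z v≢x v≢z)

      -- Otherwise π z would be adjacent to itself.
      ¬xz : ¬ Adj H x z
      ¬xz = irrefl G ∘ z-for-x

    exchange-good-x : Good π′ x
    exchange-good-x {y} xy = subst₂ (Adj G) (sym at-x) (sym (elsewhere y≢x y≢z)) (z-for-x xy)
      where
      y≢x : y ≢ x
      y≢x refl = irrefl H xy
      y≢z : y ≢ z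
      y≢z refl = ¬xz xy

    exchange-good-z : Good π′ z
    exchange-good-z {y} zy = subst₂ (Adj G) (sym at-z) (sym (elsewhere y≢x y≢z)) (x-for-z zy)
      where
      y≢x : y ≢ x
      y≢x refl = ¬xz (symm H zy)
      y≢z : y ≢ z
      y≢z refl = irrefl H zy

    exchange-good : ∀ {u} → Good π u → Good π′ u
    exchange-good {u} good {y} uy = byCases (u ≟ x) (u ≟ z) (y ≟ x) (y ≟ z)
      where
      byCases : Dec (u ≡ x) → Dec (u ≡ z) → Dec (y ≡ x) → Dec (y ≡ z) →
                Adj G (π′ ⟨$⟩ʳ u) (π′ ⟨$⟩ʳ y)
      byCases (yes refl) _          _          _          = exchange-good-x uy
      byCases (no _)     (yes refl) _          _          = exchange-good-z uy
      byCases (no _)     (no _)     (yes refl) _          = symm G (exchange-good-x (symm H uy))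
      byCases (no _)     (no _)     (no _)     (yes refl) = symm G (exchange-good-z (symm H uy))
      byCases (no u≢x)   (no u≢z)   (no y≢x)   (no y≢z)   =
        subst₂ (Adj G) (sym (elsewhere u≢x u≢z)) (sym (elsewhere y≢x y≢z)) (good uy)

-- Repairing all vertices

-- The bound is only required when there is a vertex: it is false for n = 0.
extendEmbedding : ∀ {n} (G H : Graph (Fin n)) {Δ} → maxDegree H ≤ Δ → (S : Subset n) →
                  (Fin n → 2 * Δ * (n ∸ minDegree G) ℕ.+ ∣ S ∣ ℕ.< n) →
                  (φₛ : Embedding (H [ S ]) G) → Σ[ φ ∈ Embedding H G ] φ Extends φₛ
extendEmbedding {n} G H ΔH≤Δ S few φₛ with repair (allFin n)
  where
  -- The permutation extends φₛ.
  Agrees : Permutation′ n → Set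
  Agrees π = ∀ (v : Vertices S) → π ⟨$⟩ʳ proj₁ v ≡ map φₛ v

  repair : ∀ xs → ∃[ π ] (Agrees π × (∀ {x} → x ∈ˡ xs → x ∉ S → Good G H π x))
  repair [] with π , agrees ← extendToPermutation (map φₛ) (injective φₛ) =
    π , agrees , λ ()
  repair (x ∷ xs) with repair xs | x ∈? S
  ... | π , agrees , good | yes x∈S = π , agrees , λ where
    (here refl)  x∉S → contradiction x∈S x∉S
    (there y∈xs)     → good y∈xs
  ... | π , agrees , good | no x∉S
    with z , z∉S , ex ← exchangePartner G H ΔH≤Δ S (few x) π x =
    exchange G H π x z , agrees′ , λ where
      (here refl)  _   → exchange-good-x G H π ex
      (there y∈xs) y∉S → exchange-good G H π ex (good y∈xs y∉S)
    where
    agrees′ : Agrees (exchange G H π x z)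
    agrees′ v@(_ , v∈S) = trans
      (cong (π ⟨$⟩ʳ_) (transpose-other x z (λ { refl → x∉S v∈S }) (λ { refl → z∉S v∈S })))
      (agrees v)
... | π , agrees , good = φ , agrees
  where
  preserves-edge : ∀ {x y} → Adj H x y → Adj G (π ⟨$⟩ʳ x) (π ⟨$⟩ʳ y)
  preserves-edge {x} {y} xy with x ∈? S | y ∈? S
  ... | no  x∉S | _       = good (∈-allFin x) x∉S xy
  ... | yes _   | no  y∉S = symm G (good (∈-allFin y) y∉S (symm H xy))
  ... | yes x∈S | yes y∈S = subst₂ (Adj G) (sym (agrees (x , x∈S))) (sym (agrees (y , y∈S)))
    (preserves φₛ {x , x∈S} {y , y∈S} xy)
  φ : Embedding H G
  φ = record
    { map       = π ⟨$⟩ʳ_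
    ; injective = ⟨$⟩ʳ-injective π
    ; preserves = preserves-edge
    }

lemma3p1 : ∀ (Δ : ℕ) .{{_ : NonZero Δ}} (γ : ℝ) →
    fromℕ 0 <ᴿ γ → γ <ᴿ fromℚ (+ 1 / (2 * Δ)) →
    ∀ (n : ℕ) (G H : Graph (Fin n)) →
    n · (fromℚ (+ (2 * Δ ∸ 1) / (2 * Δ)) +ᴿ γ) ≤ᴿ fromℕ (minDegree G) →
    maxDegree H ≤ Δ →
    ∀ (S : Subset n) → fromℕ ∣ S ∣ ≤ᴿ n · Δ · γ →
    ∀ (φₛ : Embedding (H [ S ]) G) →
    Σ[ φ ∈ Embedding H G ] φ Extends φₛ
lemma3p1 Δ γ 0<γ _ n G H δ-large ΔH≤Δ S S-small =
  extendEmbedding G H ΔH≤Δ S λ v →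
    slack Δ γ 0<γ n {{nonZeroIndex v}} (minDegree G) ∣ S ∣ (minDegree≤n G) δ-large S-small
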